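{- For every level $t \in \mathcal{L}$ there exist $u_1, \ldots, u_n \in \mathcal{L}_s$ (with $n \ge 0$) such that $t =_{\mathcal{L}} \max(u_1, \ldots, u_n)$.
   Context: $\operatorname{imax}\colon \mathbb{N}\times\mathbb{N}\to\mathbb{N}$ is defined by $\operatorname{imax}(i,0)=0$ and $\operatorname{imax}(i,j+1)=\max(i,j+1)$. Levels are terms of the grammar $t ::= x \mid 0 \mid s(t) \mid \max(t,t) \mid \operatorname{imax}(t,t)$, with $x$ in a countable set of variables $\mathcal{X}$; $\mathcal{L}$ is the set of levels. A valuation is $\sigma\colon\mathcal{X}\to\mathbb{N}$; values are $[0]_\sigma=0$, $[x]_\sigma=\sigma(x)$, $[s(t)]_\sigma=[t]_\sigma+1$, $[\max(t_1,t_2)]_\sigma=\max([t_1]_\sigma,[t_2]_\sigma)$, $[\operatorname{imax}(t_1,t_2)]_\sigma=\operatorname{imax}([t_1]_\sigma,[t_2]_\sigma)$. Sublevels: for finite $E\subseteq\mathcal{X}$, $x\in\mathcal{X}$, $S\in\mathbb{N}$, $[A(E,x,S)]_\sigma$ is $0$ if some $y\in E$ has $\sigma(y)=0$ and $\sigma(x)+S$ otherwise; $[B(E,S)]_\sigma$ is $0$ if some $y\in E$ has $\sigma(y)=0$ and $S$ otherwise. $\mathcal{L}_s$ is the set of sublevels $A(E,x,S)$ with $x \in E$ and $B(E,S)$ with $S > 0$. $\max$ of a finite list is evaluated pointwise, with $\max()$ (empty) having value $0$. $t_1 =_{\mathcal{L}} t_2$ means $[t_1]_\sigma=[t_2]_\sigma$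 for all valuations $\sigma$. -}

module Defs where

open import Data.Bool using (if_then_else_)
open import Data.List using (List; foldr; map)
open import Data.List.Membership.Propositional using (_∈_)
open import Data.List.Relation.Unary.Any using (any?)
open import Data.Nat using (ℕ; zero; suc; _+_; _⊔_; _>_; _≟_)
open import Relation.Nullary using (does)

imaxℕ : ℕ → ℕ → ℕ
imaxℕ i zero    = zero
imaxℕ i (suc j) = i ⊔ suc j

data Level (X : Set) : Set where
  var  : X → Level X
  zer  : Level X
  s    : Level X → Level X
  max  : Level X → Level X → Level X
  imax : Level X → Level X → Level X

Valuation : Set → Set
Valuation X = X → ℕ

⟦_⟧ : {X : Set} → Level X → Valuation X → ℕ
⟦ var x ⟧      σ = σ x
⟦ zer ⟧        σ = 0
⟦ s t ⟧        σ = ⟦ t ⟧ σ + 1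
⟦ max t₁ t₂ ⟧  σ = ⟦ t₁ ⟧ σ ⊔ ⟦ t₂ ⟧ σ
⟦ imax t₁ t₂ ⟧ σ = imaxℕ (⟦ t₁ ⟧ σ) (⟦ t₂ ⟧ σ)

-- A finite subset E of X is given by a list enumerating its elements; order
-- and repetitions are irrelevant, as only membership in E is ever used.
data Sublevel (X : Set) : Set where
  A : (E : List X) (x : X) (S : ℕ) → Sublevel X
  B : (E : List X) (S : ℕ) → Sublevel X

⟦_⟧ˢ : {X : Set} → Sublevel X → Valuation X → ℕ
⟦ A E x S ⟧ˢ σ = if does (any? (λ y → σ y ≟ 0) E) then 0 else σ x + S
⟦ B E S ⟧ˢ   σ = if does (any? (λ y → σ y ≟ 0) E) then 0 else S

data _∈𝓛ₛ {X : Set} : Sublevel X → Set where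
  A∈ : ∀ {E x S} → x ∈ E → A E x S ∈𝓛ₛ
  B∈ : ∀ {E S} → S > 0 → B E S ∈𝓛ₛ

⟦max_⟧ : {X : Set} → List (Sublevel X) → Valuation X → ℕ
⟦max us ⟧ σ = foldr _⊔_ 0 (map (λ u → ⟦ u ⟧ˢ σ) us)

{-# OPTIONS --safe #-}
module Submission where

-- Normalisation by structural induction on the level.  A variable x is
-- A({x},x,0); a successor increments every sublevel and adds B(∅,1), which
-- accounts for the sublevels that evaluate to 0.  For imax, imax(a,-)
-- distributes over max, so the second argument may be a single sublevel v
-- with index set E.  Since v ∈ 𝓛ₛ, it evaluates to 0 exactly when E meets the
-- zeros of σ, so imax(max(us),v) is the maximum of v and of the us with their
-- index sets enlarged by E.

open import Defs
open import Data.Bool using (if_then_else_; true; false)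
open import Data.List using (List; []; _∷_; _++_; map; concatMap)
open import Data.List.Membership.Propositional using (lose)
open import Data.List.Membership.Propositional.Properties using (∈-++⁺ʳ)
open import Data.List.Relation.Unary.All using (All; []; _∷_)
open import Data.List.Relation.Unary.All.Properties using (++⁺)
open import Data.List.Relation.Unary.Any using (any?; here)
open import Data.Nat using (ℕ; zero; suc; _+_; _⊔_; _>_; _≟_; s≤s; z≤n)
open import Data.Nat.Properties
open import Data.Product using (_×_; _,_; ∃-syntax)
open import Function.Bundles using (_↣_)
open import Relation.Binary.PropositionalEquality using (_≡_; refl; sym; trans; cong; cong₂; module ≡-Reasoning)
open import Relation.Nullary using (does; yes; no)

open ≡-Reasoning

private variable
  X : Set

-- The common shape of both sublevel values: by definition `A E x S` evaluates to
-- `guarded E σ (σ x + S)` and `B E S` to `guarded E σ S`, so each fact about guards serves both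
-- forms.
guarded : List X → Valuation X → ℕ → ℕ
guarded E σ n = if does (any? (λ y → σ y ≟ 0) E) then 0 else n

guarded-0 : ∀ (E : List X) σ → guarded E σ 0 ≡ 0
guarded-0 E σ with does (any? (λ y → σ y ≟ 0) E)
... | true  = refl
... | false = refl

guarded-⊔ : ∀ (E : List X) σ m n → guarded E σ (m ⊔ n) ≡ guarded E σ m ⊔ guarded E σ n
guarded-⊔ E σ m n with does (any? (λ y → σ y ≟ 0) E)
... | true  = refl
... | false = refl

guarded-++ : ∀ (E F : List X) σ n → guarded (E ++ F) σ n ≡ guarded E σ (guarded F σ n)
guarded-++ []      F σ n = refl
guarded-++ (y ∷ E) F σ n with σ y
... | zero  = refl
... | suc _ = guarded-++ E F σ n

-- If `E` contains a zero of `σ`, both sides are 1; otherwise `n + 1` is at least 1 and absorbs the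
-- extra 1.
guarded-+1 : ∀ (E : List X) σ n → guarded E σ n + 1 ≡ 1 ⊔ guarded E σ (n + 1)
guarded-+1 E σ n with does (any? (λ y → σ y ≟ 0) E)
... | true  = refl
... | false = sym (m≤n⇒m⊔n≡n (m≤n+m 1 n))

-- A zero among `m`, `n` contributes 0, which is neutral for `⊔`; when both are positive, `imaxℕ i`
-- is `i ⊔_`, which is monotone and so distributes.
imaxℕ-distribˡ-⊔ : ∀ i m n → imaxℕ i (m ⊔ n) ≡ imaxℕ i m ⊔ imaxℕ i n
imaxℕ-distribˡ-⊔ i zero    n       = refl
imaxℕ-distribˡ-⊔ i (suc m) zero    = sym (⊔-identityʳ (i ⊔ suc m))
imaxℕ-distribˡ-⊔ i (suc m) (suc n) = mono-≤-distrib-⊔ (⊔-monoʳ-≤ i) (suc m) (suc n)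

imaxℕ-pos : ∀ i {j} → j > 0 → imaxℕ i j ≡ j ⊔ i
imaxℕ-pos i {suc j} _ = ⊔-comm i (suc j)

⟦max⟧-++ : ∀ (us vs : List (Sublevel X)) σ → ⟦max us ++ vs ⟧ σ ≡ ⟦max us ⟧ σ ⊔ ⟦max vs ⟧ σ
⟦max⟧-++ []       vs σ = refl
⟦max⟧-++ (u ∷ us) vs σ = trans (cong (⟦ u ⟧ˢ σ ⊔_) (⟦max⟧-++ us vs σ)) (sym (⊔-assoc (⟦ u ⟧ˢ σ) _ _))

sucˢ : Sublevel X → Sublevel X
sucˢ (A E x S) = A E x (S + 1)
sucˢ (B E S)   = B E (S + 1)

sucˢ-∈ : ∀ {u : Sublevel X} → u ∈𝓛ₛ → sucˢ u ∈𝓛ₛ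
sucˢ-∈ (A∈ x∈E)       = A∈ x∈E
sucˢ-∈ (B∈ {S = S} _) = B∈ (m≤n+m 1 S)

⟦sucˢ⟧ : ∀ (u : Sublevel X) σ → ⟦ u ⟧ˢ σ + 1 ≡ 1 ⊔ ⟦ sucˢ u ⟧ˢ σ
⟦sucˢ⟧ (A E x S) σ = trans (guarded-+1 E σ (σ x + S)) (cong (λ n → 1 ⊔ guarded E σ n) (+-assoc (σ x) S 1))
⟦sucˢ⟧ (B E S)   σ = guarded-+1 E σ S

sucs : List (Sublevel X) → List (Sublevel X)
sucs us = B [] 1 ∷ map sucˢ us

map-sucˢ-∈ : ∀ {us : List (Sublevel X)} → All _∈𝓛ₛ us → All _∈𝓛ₛ (map sucˢ us)
map-sucˢ-∈ []       = []
map-sucˢ-∈ (p ∷ ps) = sucˢ-∈ p ∷ map-sucˢ-∈ ps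

⟦max-sucs⟧ : ∀ (us : List (Sublevel X)) σ → ⟦max us ⟧ σ + 1 ≡ ⟦max sucs us ⟧ σ
⟦max-sucs⟧ []       σ = refl
⟦max-sucs⟧ (u ∷ us) σ = begin
  (⟦ u ⟧ˢ σ ⊔ ⟦max us ⟧ σ) + 1                    ≡⟨ +-distribʳ-⊔ 1 (⟦ u ⟧ˢ σ) _ ⟩
  (⟦ u ⟧ˢ σ + 1) ⊔ (⟦max us ⟧ σ + 1)              ≡⟨ cong₂ _⊔_ (⟦sucˢ⟧ u σ) (⟦max-sucs⟧ us σ) ⟩
  -- The 1 from the head and the 1 from the tail merge, so a single `B [] 1` suffices for the whole
  -- list.
  (1 ⊔ ⟦ sucˢ u ⟧ˢ σ) ⊔ (1 ⊔ ⟦max map sucˢ us ⟧ σ) ≡⟨ mono-≤-distrib-⊔ (⊔-monoʳ-≤ 1) (⟦ sucˢ u ⟧ˢ σ) _ ⟨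
  1 ⊔ (⟦ sucˢ u ⟧ˢ σ ⊔ ⟦max map sucˢ us ⟧ σ)      ∎

support : Sublevel X → List X
support (A E x S) = E
support (B E S)   = E

-- Enlarging the index set acts on values as an outer guard by `F`, and keeps `x` in the index set
-- of an `A`.
guardˢ : List X → Sublevel X → Sublevel X
guardˢ F (A E x S) = A (F ++ E) x S
guardˢ F (B E S)   = B (F ++ E) S

⟦guardˢ⟧ : ∀ (F : List X) u σ → ⟦ guardˢ F u ⟧ˢ σ ≡ guarded F σ (⟦ u ⟧ˢ σ)
⟦guardˢ⟧ F (A E x S) σ = guarded-++ F E σ (σ x + S)
⟦guardˢ⟧ F (B E S)   σ = guarded-++ F E σ S

⟦max-guardˢ⟧ : ∀ (F : List X) us σ → ⟦max map (guardˢ F) us ⟧ σ ≡ guarded F σ (⟦max us ⟧ σ)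
⟦max-guardˢ⟧ F []       σ = sym (guarded-0 F σ)
⟦max-guardˢ⟧ F (u ∷ us) σ = trans (cong₂ _⊔_ (⟦guardˢ⟧ F u σ) (⟦max-guardˢ⟧ F us σ)) (sym (guarded-⊔ F σ (⟦ u ⟧ˢ σ) _))

map-guardˢ-∈ : ∀ (F : List X) {us} → All _∈𝓛ₛ us → All _∈𝓛ₛ (map (guardˢ F) us)
map-guardˢ-∈ F []             = []
map-guardˢ-∈ F (A∈ x∈E ∷ ps) = A∈ (∈-++⁺ʳ F x∈E) ∷ map-guardˢ-∈ F ps
map-guardˢ-∈ F (B∈ S>0 ∷ ps) = B∈ S>0 ∷ map-guardˢ-∈ F ps

-- If the support contains a zero of `σ`, every term vanishes. If not, membership in `𝓛ₛ` makes the
-- value of `v` positive, the guard is open, and `imaxℕ` is the plain maximum.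
imaxℕ-⟦⟧ˢ : ∀ i {v : Sublevel X} → v ∈𝓛ₛ → ∀ σ →
  imaxℕ i (⟦ v ⟧ˢ σ) ≡ ⟦ v ⟧ˢ σ ⊔ guarded (support v) σ i
imaxℕ-⟦⟧ˢ i (A∈ {E} {x} {S} x∈E) σ with any? (λ y → σ y ≟ 0) E
... | yes _ = refl
-- Since `x` lies in `E`, `σ x` being 0 would be a zero in `E`; hence `σ x + S` is positive even for
-- `S` equal to 0.
... | no ∄0 = imaxℕ-pos i (≤-trans (n≢0⇒n>0 (λ σx≡0 → ∄0 (lose x∈E σx≡0))) (m≤m+n (σ x) S))
imaxℕ-⟦⟧ˢ i (B∈ {E} S>0) σ with any? (λ y → σ y ≟ 0) E
... | yes _ = refl
... | no  _ = imaxℕ-pos i S>0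

imaxs : List (Sublevel X) → List (Sublevel X) → List (Sublevel X)
imaxs us = concatMap (λ v → v ∷ map (guardˢ (support v)) us)

imaxs-∈ : ∀ {us vs : List (Sublevel X)} → All _∈𝓛ₛ us → All _∈𝓛ₛ vs → All _∈𝓛ₛ (imaxs us vs)
imaxs-∈ ps []                 = []
imaxs-∈ ps (_∷_ {x = v} q qs) = q ∷ ++⁺ (map-guardˢ-∈ (support v) ps) (imaxs-∈ ps qs)

⟦max-imaxs⟧ : ∀ (us : List (Sublevel X)) {vs} → All _∈𝓛ₛ vs → ∀ σ →
  imaxℕ (⟦max us ⟧ σ) (⟦max vs ⟧ σ) ≡ ⟦max imaxs us vs ⟧ σ
⟦max-imaxs⟧ us []                             σ = refl
⟦max-imaxs⟧ us (_∷_ {x = v} {xs = vs} q qs) σ = begin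
  imaxℕ a (⟦ v ⟧ˢ σ ⊔ ⟦max vs ⟧ σ)
    ≡⟨ imaxℕ-distribˡ-⊔ a (⟦ v ⟧ˢ σ) _ ⟩
  imaxℕ a (⟦ v ⟧ˢ σ) ⊔ imaxℕ a (⟦max vs ⟧ σ)
    ≡⟨ cong₂ _⊔_ (imaxℕ-⟦⟧ˢ a q σ) (⟦max-imaxs⟧ us qs σ) ⟩
  (⟦ v ⟧ˢ σ ⊔ guarded (support v) σ a) ⊔ ⟦max imaxs us vs ⟧ σ
    ≡⟨ cong (λ n → (⟦ v ⟧ˢ σ ⊔ n) ⊔ ⟦max imaxs us vs ⟧ σ) (⟦max-guardˢ⟧ (support v) us σ) ⟨
  ⟦max v ∷ map (guardˢ (support v)) us ⟧ σ ⊔ ⟦max imaxs us vs ⟧ σ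
    ≡⟨ ⟦max⟧-++ (v ∷ map (guardˢ (support v)) us) (imaxs us vs) σ ⟨
  ⟦max imaxs us (v ∷ vs) ⟧ σ
    ∎
  where a = ⟦max us ⟧ σ

-- The guard by `x` alone is harmless: it forces 0 exactly where `σ x` is already 0.
⟦max-var⟧ : ∀ (x : X) σ → σ x ≡ ⟦max A (x ∷ []) x 0 ∷ [] ⟧ σ
⟦max-var⟧ x σ with σ x
... | zero  = refl
... | suc n = cong suc (sym (+-identityʳ n))

theorem26 : (X : Set) → X ↣ ℕ → (t : Level X) →
    ∃[ us ] (All _∈𝓛ₛ us × ((σ : Valuation X) → ⟦ t ⟧ σ ≡ ⟦max us ⟧ σ))
theorem26 X ι (var x) = A (x ∷ []) x 0 ∷ [] , A∈ (here refl) ∷ [] , ⟦max-var⟧ x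
theorem26 X ι zer     = [] , [] , λ σ → refl
theorem26 X ι (s t) with theorem26 X ι t
... | us , us∈ , t≡us =
  sucs us , B∈ (s≤s z≤n) ∷ map-sucˢ-∈ us∈ , λ σ → trans (cong (_+ 1) (t≡us σ)) (⟦max-sucs⟧ us σ)
theorem26 X ι (max t₁ t₂) with theorem26 X ι t₁ | theorem26 X ι t₂
... | us , us∈ , t₁≡us | vs , vs∈ , t₂≡vs =
  us ++ vs , ++⁺ us∈ vs∈ , λ σ → trans (cong₂ _⊔_ (t₁≡us σ) (t₂≡vs σ)) (sym (⟦max⟧-++ us vs σ))
theorem26 X ι (imax t₁ t₂) with theorem26 X ι t₁ | theorem26 X ι t₂
... | us , us∈ , t₁≡us | vs , vs∈ , t₂≡vs =
  imaxs us vs , imaxs-∈ us∈ vs∈ , λ σ → trans (cong₂ imaxℕ (t₁≡us σ) (t₂≡vs σ)) (⟦max-imaxs⟧ us vs∈ σ)
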